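{- For every infinite group $G$, $FT_G\subsetneq Sp_G$; consequently $\overline{G^*G^*}\subsetneq FT_G^{\wedge}$.
   Context: A subset $A$ of $G$ is $n$-thin ($n\in\mathbb{N}$) if for all distinct $g_0,\dots,g_n\in G$ the set $g_0A\cap\dots\cap g_nA$ is finite; finitely thin if it is $n$-thin for some $n$. $FT_G$ is the family of finitely thin subsets. $A$ is sparse if for every infinite $X\subseteq G$ there is finite $F\subseteq X$ with $\bigcap_{g\in F}gA$ finite; $Sp_G$ is the family of sparse subsets. $\beta G$ is the semigroup of ultrafilters on $G$ (with the standard extension of multiplication), $G^*$ the free ultrafilters, $\overline{G^*G^*}$ the closure of $\{pq:p,q\in G^*\}$. For an ideal $\mathcal{I}$ of subsets of $G$, $\mathcal{I}^{\wedge}=\{p\in\beta G: G\setminus A\in p$ for each $A\in\mathcal{I}\}$. -}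

module Defs where

open import Algebra.Bundles using (Group)
import Algebra.Properties.Group as GroupProperties
open import Data.Fin.Base using (Fin)
open import Data.List.Base using (List)
import Data.List.Membership.Setoid as Membership
open import Data.Nat.Base using (ℕ; suc)
open import Data.Product using (∃; ∃₂; _×_; _,_)
open import Data.Sum.Base using (_⊎_; inj₁; inj₂)
open import Function.Base using (_∘_)
open import Function.Bundles using (_⇔_)
open import Function.Definitions using (Injective)
open import Level using (Level; _⊔_; Lift; lift; lower) renaming (suc to lsuc)
open import Relation.Binary.Definitions using (_Respects_)
open import Relation.Binary.PropositionalEquality.Core using (_≡_)
open import Relation.Nullary using (¬_; contradiction)
import Relation.Unary as Pred
open Pred using (Pred)

-- The library's groups carry a setoid equality _≈_, so a subset of G is a
-- predicate that respects _≈_, and finiteness is counted up to _≈_.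
--
-- The definitions are constructive, but results about them are meant in
-- classical set theory, i.e. assuming ExcludedMiddle and Extensionality.  Since
-- Dec P holds for every type P, excluded middle gives a selection operator, and
-- with extensionality the selection depends only on the extension of a
-- Bool-valued predicate; this yields the axiom of choice and Zorn's lemma.

module OnGroup {c ℓ : Level} (G : Group c ℓ) where

  open Group G

  private
    s : Level
    s = c ⊔ ℓ

  record Subset : Set (lsuc s) where
    field
      pred : Pred Carrier s
      resp : pred Respects _≈_

  open Subset public

  infix 4 _∈_ _⊆_

  _∈_ : Carrier → Subset → Set s
  x ∈ A = pred A x

  _⊆_ : Subset → Subset → Set s
  A ⊆ B = pred A Pred.⊆ pred B

  ∅ : Subset
  ∅ .pred x = Lift s (Pred.∅ x)
  ∅ .resp _ ()

  full : Subset
  full .pred x = Lift s (Pred.U x)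
  full .resp _ x∈U = lift (lower x∈U)

  ∁ : Subset → Subset
  ∁ A .pred = Pred.∁ (pred A)
  ∁ A .resp x≈y x∉A y∈A = x∉A (resp A (sym x≈y) y∈A)

  infixr 7 _∩_

  _∩_ : Subset → Subset → Subset
  (A ∩ B) .pred = pred A Pred.∩ pred B
  (A ∩ B) .resp x≈y (x∈A , x∈B) = resp A x≈y x∈A , resp B x≈y x∈B

  ⋂ : {I : Set s} → (I → Subset) → Subset
  ⋂ {I} A .pred = Pred.⋂ I (λ i → pred (A i))
  ⋂ A .resp x≈y x∈A i = resp (A i) x≈y (x∈A i)

  infixr 7.5 _·_

  _·_ : Carrier → Subset → Subset
  (g · A) .pred x = ∃ λ a → a ∈ A × x ≈ g ∙ a
  (g · A) .resp x≈y (a , a∈A , x≈ga) = a , a∈A , trans (sym x≈y) x≈ga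

  Finite : Subset → Set s
  Finite A = ∃ λ (xs : List Carrier) → ∀ {x} → x ∈ A → x ∈ˡ xs
    where open Membership setoid renaming (_∈_ to _∈ˡ_)

  Infinite : Subset → Set s
  Infinite A = ¬ Finite A

  Thin : ℕ → Pred Subset s
  Thin n A = (g : Fin (suc n) → Carrier) → Injective _≡_ _≈_ g →
             Finite (⋂ {I = Lift s (Fin (suc n))} λ i → g (lower i) · A)

  FT : Pred Subset s
  FT A = ∃ λ n → Thin n A

  Sp : Pred Subset (lsuc s)
  Sp A = (X : Subset) → Infinite X →
         ∃ λ F → Finite F × F ⊆ X ×
                 Finite (⋂ {I = ∃ λ g → g ∈ F} λ (g , _) → g · A)

  -- Membership in an ultrafilter is valued in Set s rather than Set (lsuc s),
  -- so that { x ∣ x⁻¹A ∈ q } is again a Subset. Under excluded middle this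
  -- is no restriction, as every proposition is equivalent to one in Set s.

  record βG : Set (lsuc s) where
    field
      member   : Pred Subset s
      full∈    : member full
      ∅∉       : ¬ member ∅
      upward   : ∀ {A B} → A ⊆ B → member A → member B
      ∩-closed : ∀ {A B} → member A → member B → member (A ∩ B)
      ultra    : ∀ A → member A ⊎ member (∁ A)

  open βG public

  infix 4 _∈ᵘ_

  _∈ᵘ_ : Subset → βG → Set s
  A ∈ᵘ p = member p A

  Principal : Pred βG (lsuc s)
  Principal p = ∃ λ g → ∀ A → (A ∈ᵘ p) ⇔ (g ∈ A)

  G* : Pred βG (lsuc s)
  G* = Pred.∁ Principal

  private
    ·-mono : ∀ g {A B} → A ⊆ B → g · A ⊆ g · B
    ·-mono g A⊆B (a , a∈A , x≈ga) = a , A⊆B a∈A , x≈ga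

    ·-congˡ : ∀ {g h} A → g ≈ h → g · A ⊆ h · A
    ·-congˡ A g≈h (a , a∈A , x≈ga) = a , a∈A , trans x≈ga (∙-congʳ g≈h)

    ∙-shift : ∀ g x → x ≈ g ∙ (g ⁻¹ ∙ x)
    ∙-shift g x = sym (trans (sym (assoc g (g ⁻¹) x))
                             (trans (∙-congʳ (inverseʳ g)) (identityˡ x)))

    ·-∩ : ∀ g {A B} → g · A ∩ g · B ⊆ g · (A ∩ B)
    ·-∩ g {B = B} ((a , a∈A , x≈ga) , (b , b∈B , x≈gb)) =
      a , (a∈A , resp B (∙-cancelˡ g b a (trans (sym x≈gb) x≈ga)) b∈B) , x≈ga
      where open GroupProperties G using (∙-cancelˡ)

    ·-∁ : ∀ g A → ∁ (g · A) ⊆ g · ∁ A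
    ·-∁ g A {x} x∉gA = g ⁻¹ ∙ x , (λ y∈A → x∉gA (_ , y∈A , ∙-shift g x)) , ∙-shift g x

  quotient : βG → Subset → Subset
  quotient q A .pred x = (x ⁻¹ · A) ∈ᵘ q
  quotient q A .resp x≈y = upward q (·-congˡ A (⁻¹-cong x≈y))

  -- Multiplication on βG, in the convention that is continuous in the left
  -- argument:  A ∈ pq  iff  { x ∣ x⁻¹A ∈ q } ∈ p.

  infixl 7 _∙ᵘ_

  _∙ᵘ_ : βG → βG → βG
  (p ∙ᵘ q) .member A = quotient q A ∈ᵘ p
  (p ∙ᵘ q) .full∈ =
    upward p (λ {x} _ → upward q (λ {y} _ → _ , lift _ , ∙-shift (x ⁻¹) y) (full∈ q)) (full∈ p)
  (p ∙ᵘ q) .∅∉ =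
    ∅∉ p ∘ upward p (λ ∅∈q → lift (∅∉ q (upward q (λ { (_ , () , _) }) ∅∈q)))
  (p ∙ᵘ q) .upward {A} {B} A⊆B = upward p λ {x} → upward q (·-mono (x ⁻¹) {A} {B} A⊆B)
  (p ∙ᵘ q) .∩-closed {A} {B} A∈ B∈ =
    upward p (λ {x} (a , b) → upward q (·-∩ (x ⁻¹) {A} {B}) (∩-closed q a b))
             (∩-closed p A∈ B∈)
  (p ∙ᵘ q) .ultra A with ultra p (quotient q A)
  ... | inj₁ yes = inj₁ yes
  ... | inj₂ no  = inj₂ (upward p complement no)
    where
    complement : ∁ (quotient q A) ⊆ quotient q (∁ A)
    complement {x} x∉ with ultra q (x ⁻¹ · A)
    ... | inj₁ in-q  = contradiction in-q x∉
    ... | inj₂ out-q = upward q (·-∁ (x ⁻¹) A) out-q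

  G*G* : Pred βG (lsuc s)
  G*G* r = ∃₂ λ p q → p Pred.∈ G* × q Pred.∈ G* × (∀ A → (A ∈ᵘ r) ⇔ (A ∈ᵘ p ∙ᵘ q))

  -- The topology of βG has the sets { p ∣ A ∈ p }, for A ⊆ G, as a base.

  closure : ∀ {a} → Pred βG a → Pred βG (lsuc s ⊔ a)
  closure S p = ∀ A → A ∈ᵘ p → ∃ λ q → q Pred.∈ S × A ∈ᵘ q

  -- Defined for any family I of subsets, not only for ideals.

  infix 9 _^∧

  _^∧ : ∀ {a} → Pred Subset a → Pred βG (lsuc s ⊔ a)
  (I ^∧) p = ∀ A → A Pred.∈ I → ∁ A ∈ᵘ p

-- Finitely thin sets are sparse: any n + 1 elements of an infinite X serve as F.
-- For strictness choose a sequence t in which each t l avoids all short words in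
-- ε and the earlier terms, and take A = { t i ∙ t j ∣ i < j, ν j ≤ i ≤ 2 (ν j) },
-- where ν : ℕ → ℕ takes every value infinitely often.  The n + 1 translates of A by
-- (t n)⁻¹, …, (t 2n)⁻¹ share every t j with ν j = n and j large, so A is not
-- finitely thin.  Given f ≠ g in X, a point y ∈ fA ∩ gA is, up to finitely many
-- exceptions, f (t i) (t j) = g (t k) (t j) with the same last factor; then f⁻¹g
-- bounds i, hence ν j, and a third h ∈ X outside a finite set depending on that
-- bound makes fA ∩ gA ∩ hA finite.
--
-- A free ultrafilter contains only infinite sets, so no sparse set belongs to a
-- member of G*G*.  Conversely FT is an ideal not containing A, so some ultrafilter
-- contains A and the complement of each finitely thin set.
module Submission where

open import Defs
open import Algebra.Bundles using (Group)
import Algebra.Properties.Group as GroupProperties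
open import Axiom.Extensionality.Propositional using (Extensionality)
open import Axiom.ExcludedMiddle using (ExcludedMiddle)
open import Data.Bool.Base using (Bool; true; false; T; not; _∧_; _∨_)
open import Data.Bool.Properties using (T-∧; T-∨)
open import Data.Empty using (⊥; ⊥-elim)
open import Data.Fin.Base as Fin using (Fin; toℕ; inject≤)
open import Data.Fin.Properties using (toℕ-injective; toℕ≤pred[n]; inject≤-injective)
open import Data.List.Base using (List; []; _∷_; [_]; _++_; map; length; lookup; tabulate; cartesianProductWith)
open import Data.List.Properties using (length-tabulate)
import Data.List.Membership.Setoid as Membership
import Data.List.Membership.Setoid.Properties as Mem
open import Data.List.Membership.Propositional.Properties using (∈-lookup)
open import Data.List.Relation.Unary.All as All using (All; []; _∷_)
import Data.List.Relation.Unary.All.Properties as All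
open import Data.List.Relation.Unary.AllPairs using ([]; _∷_)
open import Data.List.Relation.Unary.Any as Any using (here; there)
import Data.List.Relation.Unary.Unique.Setoid as Unique
import Data.List.Relation.Unary.Unique.Setoid.Properties as UniqueP
open import Data.Nat.Base using (ℕ; zero; suc; _+_; _*_; _≤_; _<_; _⊔_; z≤n; s≤s; _≤′_; ≤′-refl; ≤′-step)
import Data.Nat.Properties as ℕ
open import Data.Nat.Binary.Base using (ℕᵇ; 2[1+_]; 1+[2_]; fromℕ) renaming (zero to 0ᵇ; toℕ to toℕᵇ)
open import Data.Nat.Binary.Properties using (fromℕ-toℕ; toℕ-fromℕ)
open import Data.Product using (∃; ∃₂; ∃-syntax; _×_; _,_; proj₁; proj₂)
open import Data.Sum.Base as Sum using (_⊎_; inj₁; inj₂; [_,_]′)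
open import Function.Base using (_∘_; id; const)
open import Function.Bundles using (mk⇔; Equivalence)
open import Level using (Level; Lift; lift; lower)
open import Relation.Binary.Definitions using (tri<; tri≈; tri>)
open import Relation.Binary.PropositionalEquality as ≡ using (_≡_; _≢_; cong; subst)
open import Relation.Nullary using (¬_; Dec; yes; no; contradiction)
open import Relation.Nullary.Decidable using (⌊_⌋; toWitness; fromWitness; decidable-stable)
open import Relation.Unary using (_⊂_)

-- Prime ideals in algebras of Bool-valued predicates.

module PrimeIdeal
  (em : ∀ a → ExcludedMiddle a)
  (ext : ∀ a b → Extensionality a b)
  where

  private
    variable
      a : Level
      D : Set a

  ⟦_⟧ : Set a → Bool
  ⟦ P ⟧ = ⌊ em _ {P} ⌋

  infix 4 _≼_

  _≼_ : (D → Bool) → (D → Bool) → Set _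
  F ≼ H = ∀ {d} → T (F d) → T (H d)

  T-antisym : ∀ {x y} → (T x → T y) → (T y → T x) → x ≡ y
  T-antisym {false} {false} _ _ = ≡.refl
  T-antisym {false} {true}  _ g = ⊥-elim (g _)
  T-antisym {true}  {false} f _ = ⊥-elim (f _)
  T-antisym {true}  {true}  _ _ = ≡.refl

  ≼-antisym : {F H : D → Bool} → F ≼ H → H ≼ F → F ≡ H
  ≼-antisym F≼H H≼F = ext _ _ λ _ → T-antisym F≼H H≼F

  -- Transfinite iteration of next without ordinals, which replaces Zorn's lemma.
  module Tower
    {D : Set a} (start : D → Bool)
    (next : (D → Bool) → (D → Bool)) (next-≽ : ∀ F → F ≼ next F)
    where

    ⋃ : ((D → Bool) → Bool) → D → Bool
    ⋃ S d = ⟦ (∃[ F ] T (S F) × T (F d)) ⟧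

    -- Families are Bool-valued to keep `Stage` in `Set a`; excluded middle makes the family of all
    -- stages one of them, so its union `top` is itself a stage. Families in `sup` are inhabited so
    -- that every stage contains `start`.
    data Stage : (D → Bool) → Set a where
      base : Stage start
      step : ∀ {F} → Stage F → Stage (next F)
      sup  : ∀ S → ∃ (T ∘ S) → (∀ F → T (S F) → Stage F) → Stage (⋃ S)

    start-≼ : ∀ {F} → Stage F → start ≼ F
    start-≼ base p = p
    start-≼ (step s) p = next-≽ _ (start-≼ s p)
    start-≼ (sup S (F , F∈S) s) p = fromWitness (F , F∈S , start-≼ (s F F∈S) p)

    -- Totality alone would not pass through `step`: there the second call, with the stages
    -- exchanged, has to give `next F ≼ H`. When both calls return mere inclusions, extensionality
    -- makes `F` and `H` equal, hence also their successors.
    compare : ∀ {F H} → Stage F → Stage H → F ≼ H ⊎ next H ≼ F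
    compare base h = inj₁ (start-≼ h)
    compare {H = H} (step {F} f) h with compare f h | compare h f
    ... | inj₂ H′≼F | _          = inj₂ λ p → next-≽ F (H′≼F p)
    ... | inj₁ _    | inj₂ F′≼H  = inj₁ F′≼H
    ... | inj₁ F≼H  | inj₁ H≼F   =
      inj₂ λ {d} → subst (λ E → T (next E d)) (≼-antisym {F = H} {H = F} H≼F F≼H)
    compare {H = H} (sup S _ s) h
      with em _ {∃[ F ] T (S F) × next H ≼ F}
    ... | yes (F , F∈S , H′≼F) = inj₂ λ p → fromWitness (F , F∈S , H′≼F p)
    ... | no none = inj₁ below
      where
      below : ⋃ S ≼ H
      below p with toWitness p
      ... | F , F∈S , d∈F with compare (s F F∈S) h
      ...   | inj₁ F≼H  = F≼H d∈F
      ...   | inj₂ H′≼F = contradiction (F , F∈S , (λ {d} → H′≼F {d})) none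

    total : ∀ {F H} → Stage F → Stage H → F ≼ H ⊎ H ≼ F
    total {H = H} f h = Sum.map₂ (λ H′≼F p → H′≼F (next-≽ H p)) (compare f h)

    top : D → Bool
    top = ⋃ (λ F → ⟦ Stage F ⟧)

    top-stage : Stage top
    top-stage = sup _ (start , fromWitness base) (λ _ → toWitness)

    top-closed : next top ≼ top
    top-closed p = fromWitness (next top , fromWitness (step top-stage) , p)

  record IsIdeal {C : Set a} (I : (C → Bool) → Bool) : Set a where
    field
      empty  : T (I (const false))
      down   : ∀ {d e} → d ≼ e → T (I e) → T (I d)
      join   : ∀ {d e} → T (I d) → T (I e) → T (I (λ x → d x ∨ e x))
      proper : ¬ T (I (const true))

  module _ {C : Set a} where

    open IsIdeal

    infixl 6 _∖_

    _∖_ : (C → Bool) → (C → Bool) → C → Bool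
    (d ∖ e) x = d x ∧ not (e x)

    Undecided : ((C → Bool) → Bool) → Set a
    Undecided I = ∃[ d ] ¬ T (I d) × ¬ T (I (not ∘ d))

    -- For an ideal `I`, this is the ideal generated by `I` and `d`, possibly improper. The disjunct
    -- `I e` makes `extend-≽` hold for every `I`, as `Tower` requires.
    adjoin : ((C → Bool) → Bool) → (C → Bool) → (C → Bool) → Bool
    adjoin I d e = I e ∨ I (e ∖ d)

    extendBy : ∀ I → Dec (Undecided I) → (C → Bool) → Bool
    extendBy I (yes (d , _)) = adjoin I d
    extendBy I (no _)        = I

    -- The set adjoined is the one packed in the decision em _, so it depends
    -- only on the Bool-valued I: equal stages have equal extensions.
    extend : ((C → Bool) → Bool) → (C → Bool) → Bool
    extend I = extendBy I (em _)

    extend-≽ : ∀ I → I ≼ extend I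
    extend-≽ I p with em _ {Undecided I}
    ... | yes _ = Equivalence.from T-∨ (inj₁ p)
    ... | no  _ = p

    adjoin-⇒ : ∀ {I} → IsIdeal I → ∀ {d e} → T (adjoin I d e) → T (I (e ∖ d))
    adjoin-⇒ ideal {d} p =
      [ down ideal (λ p → proj₁ (Equivalence.to T-∧ p)) , id ]′ (Equivalence.to T-∨ p)

    adjoin-⇐ : ∀ I {d e} → T (I (e ∖ d)) → T (adjoin I d e)
    adjoin-⇐ I {d} {e} p = Equivalence.from (T-∨ {I e}) (inj₂ p)

    extend-ideal : ∀ {I} → IsIdeal I → IsIdeal (extend I)
    extend-ideal {I} ideal with em _ {Undecided I}
    ... | no _ = ideal
    ... | yes (d , d∉ , ∁d∉) = record
      { empty  = Equivalence.from T-∨ (inj₁ (empty ideal))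
      ; down   = λ x≼y y∈ → adjoin-⇐ I (down ideal (λ p →
          let q , r = Equivalence.to T-∧ p in Equivalence.from T-∧ (x≼y q , r)) (adjoin-⇒ ideal y∈))
      ; join   = λ {x} {y} x∈ y∈ → adjoin-⇐ I (down ideal (λ {z} → distrib (x z) (y z) (d z))
          (join ideal (adjoin-⇒ ideal x∈) (adjoin-⇒ ideal y∈)))
      -- The full predicate minus `d` reduces to `not ∘ d`, which is outside `I` because `d` is
      -- undecided.
      ; proper = λ p → ∁d∉ (adjoin-⇒ ideal p)
      }
      where
      distrib : ∀ x y z → T ((x ∨ y) ∧ not z) → T (x ∧ not z ∨ y ∧ not z)
      distrib true  _     false _ = _
      distrib false true  false _ = _

    -- Every stage is a proper ideal, unions being handled by `total`. If `top` left some set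
    -- undecided, `extend` would adjoin such a set, and `top-closed` would put it into `top`.
    prime-ideal : ∀ {I} → IsIdeal I →
                  ∃[ M ] IsIdeal M × I ≼ M × (∀ d → T (M d) ⊎ T (M (not ∘ d)))
    prime-ideal {I} I-ideal = top , stage-ideal top-stage , start-≼ top-stage , prime
      where
      open Tower I extend extend-≽

      stage-ideal : ∀ {F} → Stage F → IsIdeal F
      stage-ideal base     = I-ideal
      stage-ideal (step s) = extend-ideal (stage-ideal s)
      stage-ideal (sup S (F₀ , F₀∈S) s) = record
        { empty  = fromWitness (F₀ , F₀∈S , empty (stage-ideal (s F₀ F₀∈S)))
        ; down   = λ x≼y y∈ → let F , F∈S , y∈F = toWitness y∈ in
            fromWitness (F , F∈S , down (stage-ideal (s F F∈S)) x≼y y∈F)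
        ; join   = λ x∈ y∈ →
            let F , F∈S , x∈F = toWitness x∈
                H , H∈S , y∈H = toWitness y∈
            in fromWitness ([ (λ F≼H → H , H∈S , join (stage-ideal (s H H∈S)) (F≼H x∈F) y∈H)
                            , (λ H≼F → F , F∈S , join (stage-ideal (s F F∈S)) x∈F (H≼F y∈H))
                            ]′ (total (s F F∈S) (s H H∈S)))
        ; proper = λ p → let F , F∈S , full∈F = toWitness p in
            proper (stage-ideal (s F F∈S)) full∈F
        }

      decided : ¬ Undecided top
      decided u with em _ {Undecided top} | top-closed
      ... | no ¬u            | _      = ¬u u
      -- This `d` is the set picked by `em`, which need not be the one in `u`.
      ... | yes (d , d∉ , _) | closed = d∉ (closed (adjoin-⇐ top {d} {d}
        (down (stage-ideal top-stage) (λ {x} → ∖-self (d x)) (empty (stage-ideal top-stage)))))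
        where
        ∖-self : ∀ y → T (y ∧ not y) → ⊥
        ∖-self true ()
        ∖-self false ()

      prime : ∀ d → T (top d) ⊎ T (top (not ∘ d))
      prime d with em _ {T (top d)} | em _ {T (top (not ∘ d))}
      ... | yes p | _     = inj₁ p
      ... | no  _ | yes p = inj₂ p
      ... | no  p | no  q = contradiction (d , p , q) decided

-- A map on the naturals with unbounded fibres.

trailing : ℕᵇ → ℕ
trailing 0ᵇ       = 0
trailing 2[1+ b ] = suc (trailing b)
trailing 1+[2 _ ] = 0

ν : ℕ → ℕ
ν = trailing ∘ fromℕ

-- `ℕᵇ` is bijective base two, and `ν` counts the final digits 2. The witness is the numeral of `N`,
-- then a digit 1 to stop the count, then `n` digits 2.
ν-fibre-unbounded : ∀ n N → ∃[ j ] N ≤ j × ν j ≡ n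
ν-fibre-unbounded n N = toℕᵇ (code n) , large n ,
  ≡.trans (cong trailing (fromℕ-toℕ (code n))) (trailing-code n)
  where
  code : ℕ → ℕᵇ
  code zero    = 1+[2 fromℕ N ]
  code (suc n) = 2[1+ code n ]

  trailing-code : ∀ n → trailing (code n) ≡ n
  trailing-code zero    = ≡.refl
  trailing-code (suc n) = cong suc (trailing-code n)

  large : ∀ n → N ≤ toℕᵇ (code n)
  large zero    = ℕ.m≤n⇒m≤1+n (ℕ.≤-trans (ℕ.≤-reflexive (≡.sym (toℕ-fromℕ N))) (ℕ.m≤n*m _ 2))
  large (suc n) = ℕ.≤-trans (ℕ.m≤n⇒m≤1+n (large n)) (ℕ.m≤n*m _ 2)

module Thinness
  (em : ∀ a → ExcludedMiddle a)
  (ext : ∀ a b → Extensionality a b)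
  {c ℓ} (G : Group c ℓ)
  where

  open Group G
  open GroupProperties G
  open OnGroup G
  open Membership setoid renaming (_∈_ to _∈ˡ_; _∉_ to _∉ˡ_)
  open Unique setoid using (Unique)
  open PrimeIdeal em ext

  private
    variable
      m n : ℕ

  -- Translates and unions of finitely thin sets.

  byContradiction : ∀ {a} {P : Set a} → ¬ ¬ P → P
  byContradiction = decidable-stable (em _)

  finite-⊆ : ∀ A B → A ⊆ B → Finite B → Finite A
  finite-⊆ A B A⊆B (xs , B⊆xs) = xs , λ x∈A → B⊆xs (A⊆B x∈A)

  infixr 6 _∪_

  _∪_ : Subset → Subset → Subset
  (A ∪ B) .pred x = x ∈ A ⊎ x ∈ B
  (A ∪ B) .resp x≈y = Sum.map (resp A x≈y) (resp B x≈y)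

  finite-⊎ : ∀ A B C → (∀ {x} → x ∈ C → x ∈ A ⊎ x ∈ B) → Finite A → Finite B → Finite C
  finite-⊎ A B C C⊆A⊎B (xs , A⊆xs) (ys , B⊆ys) = xs ++ ys , λ x∈C →
    [ Mem.∈-++⁺ˡ setoid ∘ A⊆xs , Mem.∈-++⁺ʳ setoid xs ∘ B⊆ys ]′ (C⊆A⊎B x∈C)

  ·-mono : ∀ g A B → A ⊆ B → g · A ⊆ g · B
  ·-mono g A B A⊆B (a , a∈A , x≈ga) = a , A⊆B a∈A , x≈ga

  thin-⊆ : ∀ A B → A ⊆ B → Thin n B → Thin n A
  thin-⊆ A B A⊆B thin g g-inj =
    finite-⊆ (⋂ λ i → g (lower i) · A) (⋂ λ i → g (lower i) · B)
      (λ x∈ i → ·-mono (g (lower i)) A B A⊆B (x∈ i)) (thin g g-inj)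

  -- Indexing by lists instead of `Fin` lets `finite-split` move the translates one at a time.
  ⋂· : List Carrier → Subset → Subset
  ⋂· gs A .pred x = All (λ g → x ∈ g · A) gs
  ⋂· gs A .resp x≈y = All.map λ {g} → resp (g · A) x≈y

  unique-lookup : ∀ {xs} → Unique xs → ∀ {i j} → lookup xs i ≈ lookup xs j → i ≡ j
  unique-lookup (_ ∷ _)    {Fin.zero}  {Fin.zero}  _  = ≡.refl
  unique-lookup (x∉ ∷ _)   {Fin.zero}  {Fin.suc j} eq = contradiction eq (All.lookup x∉ (∈-lookup j))
  unique-lookup (x∉ ∷ _)   {Fin.suc i} {Fin.zero}  eq = contradiction (sym eq) (All.lookup x∉ (∈-lookup i))
  unique-lookup (_ ∷ uniq) {Fin.suc i} {Fin.suc j} eq = cong Fin.suc (unique-lookup uniq eq)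

  thin⇒finite : ∀ A {gs} → Thin n A → Unique gs → n < length gs → Finite (⋂· gs A)
  thin⇒finite {n} A {gs} thin uniq n<l =
    finite-⊆ (⋂· gs A) (⋂ λ i → g (lower i) · A) (λ x∈ i → All.lookup x∈ (∈-lookup (inject≤ (lower i) n<l)))
      (thin g (λ eq → inject≤-injective n<l n<l _ _ (unique-lookup uniq eq)))
    where
    g : Fin (suc n) → Carrier
    g i = lookup gs (inject≤ i n<l)

  -- Each translate in gs is moved either to as or to bs, and the lists are
  -- long enough for one of them to end up exceeding its thinness.
  finite-split : ∀ A B C → (∀ {x} → x ∈ C → x ∈ A ⊎ x ∈ B) → Thin m A → Thin n B →
                 ∀ as bs gs → Unique as → Unique bs → Unique gs →
                 All (λ g → All (g ≉_) as × All (g ≉_) bs) gs →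
                 m + n < length gs + (length as + length bs) →
                 Finite (⋂· as A ∩ ⋂· bs B ∩ ⋂· gs C)
  finite-split {m} {n} A B C C⊆ thinA thinB as bs [] as! bs! _ _ long
    with m ℕ.<? length as | n ℕ.<? length bs
  ... | yes m< | _      = finite-⊆ (⋂· as A ∩ ⋂· bs B ∩ ⋂· [] C) (⋂· as A) proj₁ (thin⇒finite A thinA as! m<)
  ... | no  _  | yes n< = finite-⊆ (⋂· as A ∩ ⋂· bs B ∩ ⋂· [] C) (⋂· bs B) (proj₁ ∘ proj₂) (thin⇒finite B thinB bs! n<)
  ... | no m≮  | no n≮  = contradiction long (ℕ.≤⇒≯ (ℕ.+-mono-≤ (ℕ.≮⇒≥ m≮) (ℕ.≮⇒≥ n≮)))
  finite-split {m} {n} A B C C⊆ thinA thinB as bs (g ∷ gs) as! bs! (g∉ ∷ gs!) ((g∉as , g∉bs) ∷ apart) long =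
    finite-⊎ (⋂· (g ∷ as) A ∩ ⋂· bs B ∩ ⋂· gs C) (⋂· as A ∩ ⋂· (g ∷ bs) B ∩ ⋂· gs C)
             (⋂· as A ∩ ⋂· bs B ∩ ⋂· (g ∷ gs) C) split
      (finite-split A B C C⊆ thinA thinB (g ∷ as) bs gs (g∉as ∷ as!) bs! gs!
        (All.zipWith (λ ((h∉as , h∉bs) , g≉h) → (g≉h ∘ sym ∷ h∉as) , h∉bs) (apart , g∉))
        (subst (m + n <_) (≡.sym (ℕ.+-suc (length gs) _)) long))
      (finite-split A B C C⊆ thinA thinB as (g ∷ bs) gs as! (g∉bs ∷ bs!) gs!
        (All.zipWith (λ ((h∉as , h∉bs) , g≉h) → h∉as , (g≉h ∘ sym ∷ h∉bs)) (apart , g∉))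
        (subst (m + n <_) (≡.sym (≡.trans (cong (length gs +_) (ℕ.+-suc (length as) _))
                                          (ℕ.+-suc (length gs) _))) long))
    where
    split : ∀ {x} → x ∈ ⋂· as A ∩ ⋂· bs B ∩ ⋂· (g ∷ gs) C →
            x ∈ ⋂· (g ∷ as) A ∩ ⋂· bs B ∩ ⋂· gs C ⊎ x ∈ ⋂· as A ∩ ⋂· (g ∷ bs) B ∩ ⋂· gs C
    split (x∈as , x∈bs , (y , y∈C , x≈gy) ∷ x∈gs) with C⊆ y∈C
    ... | inj₁ y∈A = inj₁ ((y , y∈A , x≈gy) ∷ x∈as , x∈bs , x∈gs)
    ... | inj₂ y∈B = inj₂ (x∈as , (y , y∈B , x≈gy) ∷ x∈bs , x∈gs)

  -- By pigeonhole, a point common to `m + n + 1` translates of the union lies in `m + 1` of the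
  -- translates of `A` or in `n + 1` of those of `B`. There are finitely many such choices of
  -- translates.
  FT-∪ : ∀ A B → FT A → FT B → FT (A ∪ B)
  FT-∪ A B (m , thinA) (n , thinB) = m + n , λ g g-inj →
    let gs = tabulate g in
    finite-⊆ (⋂ λ i → g (lower i) · (A ∪ B)) (⋂· [] A ∩ ⋂· [] B ∩ ⋂· gs (A ∪ B)) (λ x∈ → [] , [] , All.tabulate⁺ (λ i → x∈ (lift i)))
      (finite-split A B (A ∪ B) id thinA thinB [] [] gs [] [] (UniqueP.tabulate⁺ setoid g-inj)
        (All.universal (λ _ → [] , []) gs)
        (subst (m + n <_) (≡.sym (≡.trans (ℕ.+-identityʳ _) (length-tabulate g))) ℕ.≤-refl))

  -- Finitely thin sets are sparse.

  infinite⇒fresh : ∀ X → Infinite X → ∀ xs → ∃[ x ] x ∈ X × x ∉ˡ xs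
  infinite⇒fresh X inf xs = byContradiction λ none →
    inf (xs , λ x∈X → byContradiction λ x∉xs → none (_ , x∈X , x∉xs))

  distinct-elements : ∀ X → Infinite X → ∀ n →
                      ∃[ xs ] Unique xs × All (_∈ X) xs × length xs ≡ n
  distinct-elements X inf zero = [] , [] , [] , ≡.refl
  distinct-elements X inf (suc n) with distinct-elements X inf n
  ... | xs , xs! , xs⊆X , len with infinite⇒fresh X inf xs
  ...   | x , x∈X , x∉xs = x ∷ xs , All.¬Any⇒All¬ xs x∉xs ∷ xs! , x∈X ∷ xs⊆X , cong suc len

  listed : List Carrier → Subset
  listed xs .pred = _∈ˡ xs
  listed xs .resp = Mem.∈-resp-≈ setoid

  listed-⊆ : ∀ X {xs} → All (_∈ X) xs → listed xs ⊆ X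
  listed-⊆ X (x∈X ∷ _)  (here y≈x)   = resp X (sym y≈x) x∈X
  listed-⊆ X (_ ∷ xs⊆X) (there y∈xs) = listed-⊆ X xs⊆X y∈xs

  ⋂-listed : ∀ A {gs} → (⋂ {I = ∃ λ g → g ∈ listed gs} λ (g , _) → g · A) ⊆ ⋂· gs A
  ⋂-listed A x∈ = All.tabulate λ g∈ → x∈ (_ , Any.map reflexive g∈)

  FT⊆Sp : ∀ A → FT A → Sp A
  FT⊆Sp A (n , thin) X inf with distinct-elements X inf (suc n)
  ... | gs , gs! , gs⊆X , len =
    listed gs , (gs , id) , listed-⊆ X gs⊆X ,
    finite-⊆ (⋂ {I = ∃ λ g → g ∈ listed gs} λ (g , _) → g · A) (⋂· gs A) (⋂-listed A)
      (thin⇒finite A thin gs! (ℕ.≤-reflexive (≡.sym len)))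

  -- Ultrafilters in relation to sparse and finitely thin sets.

  free⇒infinite : ∀ p A → G* p → A ∈ᵘ p → Infinite A
  free⇒infinite p A free A∈p (xs , A⊆xs) = go xs (upward p A⊆xs A∈p)
    where
    go : ∀ xs → ¬ listed xs ∈ᵘ p
    go [] h = ∅∉ p (upward p (λ ()) h)
    go (x ∷ xs) h with ultra p (listed [ x ])
    ... | inj₁ x∈p = free (x , λ B → mk⇔
      (λ B∈p → byContradiction λ x∉B → ∅∉ p (upward p
        (λ { (y∈B , here y≈x) → contradiction (resp B y≈x y∈B) x∉B }) (∩-closed p B∈p x∈p)))
      (λ x∈B → upward p (λ { (here y≈x) → resp B (sym y≈x) x∈B }) x∈p))
    ... | inj₂ x∉p = go xs (upward p
      (λ { (here y≈x , y≉x) → contradiction (here y≈x) y≉x ; (there y∈xs , _) → y∈xs })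
      (∩-closed p h x∉p))

  -- The list witnessing `Finite F` may have entries outside `F`, about which nothing is known;
  -- hence the restriction to `F` in `⋂F` and the case distinction on `x ∈ F`.
  ⋂∈ultrafilter : ∀ q A F → Finite F → (∀ {g} → g ∈ F → (g · A) ∈ᵘ q) →
                  (⋂ {I = ∃ λ g → g ∈ F} λ (g , _) → g · A) ∈ᵘ q
  ⋂∈ultrafilter q A F (xs , F⊆xs) F·A∈q =
    upward q (λ x∈ (g , g∈F) → x∈ (g , g∈F , F⊆xs g∈F)) (go xs)
    where
    ⋂F : List Carrier → Subset
    ⋂F xs = ⋂ {I = ∃ λ g → g ∈ F × g ∈ˡ xs} λ (g , _) → g · A

    go : ∀ xs → ⋂F xs ∈ᵘ q
    go [] = upward q (λ { _ (_ , _ , ()) }) (full∈ q)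
    go (x ∷ xs) with em _ {x ∈ F}
    ... | no x∉F = upward q
      (λ { y∈ (g , g∈F , here g≈x)   → contradiction (resp F g≈x g∈F) x∉F
         ; y∈ (g , g∈F , there g∈xs) → y∈ (g , g∈F , g∈xs) }) (go xs)
    ... | yes x∈F = upward q
      (λ { ((a , a∈A , y≈xa) , _) (g , g∈F , here g≈x) → a , a∈A , trans y≈xa (∙-congʳ (sym g≈x))
         ; (_ , y∈) (g , g∈F , there g∈xs) → y∈ (g , g∈F , g∈xs) })
      (∩-closed q {x · A} {⋂F xs} (F·A∈q x∈F) (go xs))

  -- The set `X` of all `g` with `g · A` in `q` is the inverse of `quotient q A`, a member of the
  -- free `p`, so it is infinite. Sparseness then yields a finite intersection of translates that
  -- belongs to the free `q`.
  sparse∉G*G* : ∀ r A → Sp A → G*G* r → ¬ A ∈ᵘ r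
  sparse∉G*G* r A sparse (p , q , free-p , free-q , r⇔pq) A∈r =
    let F , F-fin , F⊆X , ⋂-fin = sparse X X-infinite in
    free⇒infinite q (⋂ {I = ∃ λ g → g ∈ F} λ (g , _) → g · A) free-q (⋂∈ultrafilter q A F F-fin F⊆X) ⋂-fin
    where
    X : Subset
    X .pred g = (g · A) ∈ᵘ q
    X .resp g≈h = upward q λ (a , a∈A , x≈ga) → a , a∈A , trans x≈ga (∙-congʳ g≈h)

    X-infinite : Infinite X
    X-infinite (xs , X⊆xs) =
      free⇒infinite p (quotient q A) free-p (Equivalence.to (r⇔pq A) A∈r)
        (map _⁻¹ xs , λ {x} x∈Q → Mem.∈-resp-≈ setoid (⁻¹-involutive x)
          (Mem.∈-map⁺ setoid setoid ⁻¹-cong (X⊆xs x∈Q)))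

  closure⊆FT^∧ : ∀ r → closure G*G* r → (FT ^∧) r
  closure⊆FT^∧ r r∈cl B B∈FT with ultra r B
  ... | inj₂ ∁B∈r = ∁B∈r
  ... | inj₁ B∈r with r∈cl B B∈r
  ...   | q , q∈G*G* , B∈q = contradiction B∈q (sparse∉G*G* q B (FT⊆Sp B B∈FT) q∈G*G*)

  -- `Small` describes the ideal generated by the finitely thin sets and the complement of `A`. It
  -- is proper since `A` is not finitely thin, and the sets outside a prime ideal containing it form
  -- the ultrafilter.
  ultrafilter-avoiding-FT : ∀ A → ¬ FT A → ∃[ p ] (FT ^∧) p × A ∈ᵘ p
  ultrafilter-avoiding-FT A A∉FT = p , ∁∈p , A∈p
    where
    open IsIdeal

    Small : (Carrier → Bool) → Set _
    Small d = ∃[ B ] FT B × (∀ x → x ∈ A → T (d x) → x ∈ B)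

    ∅∈FT : FT ∅
    ∅∈FT = 0 , λ g _ → [] , λ x∈ → ⊥-elim (lower (proj₁ (proj₂ (x∈ (lift Fin.zero)))))

    small-ideal : IsIdeal (λ d → ⟦ Small d ⟧)
    small-ideal .empty = fromWitness (∅ , ∅∈FT , λ _ _ → ⊥-elim)
    small-ideal .down d≼e e∈ =
      let B , B∈FT , e⊆B = toWitness e∈ in fromWitness (B , B∈FT , λ x x∈A → e⊆B x x∈A ∘ d≼e)
    small-ideal .join {d} d∈ e∈ =
      let B , B∈FT , d⊆B = toWitness d∈
          C , C∈FT , e⊆C = toWitness e∈
      in fromWitness (B ∪ C , FT-∪ B C B∈FT C∈FT , λ x x∈A →
           Sum.map (d⊆B x x∈A) (e⊆C x x∈A) ∘ Equivalence.to T-∨)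
    small-ideal .proper p =
      let B , (n , thin) , A⊆B = toWitness p in A∉FT (n , thin-⊆ A B (λ x∈A → A⊆B _ x∈A _) thin)

    M = proj₁ (prime-ideal small-ideal)
    M-ideal = proj₁ (proj₂ (prime-ideal small-ideal))
    small⇒M = proj₁ (proj₂ (proj₂ (prime-ideal small-ideal)))
    M-prime = proj₂ (proj₂ (proj₂ (prime-ideal small-ideal)))

    χ : Subset → Carrier → Bool
    χ B x = ⟦ x ∈ B ⟧

    not-covered : ∀ {d e} → (∀ x → T (d x) ⊎ T (e x)) → T (M d) → ¬ T (M e)
    not-covered cover d∈ e∈ =
      proper M-ideal (down M-ideal (λ {x} _ → Equivalence.from T-∨ (cover x)) (join M-ideal d∈ e∈))

    χ-or-∁ : ∀ B x → T (χ B x) ⊎ T (χ (∁ B) x)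
    χ-or-∁ B x with em _ {x ∈ B}
    ... | yes _  = inj₁ _
    ... | no x∉B = inj₂ (fromWitness x∉B)

    p : βG
    -- `M` is Bool-valued, so membership fits into the level that `βG` demands.
    p .member B = Lift _ (¬ T (M (χ B)))
    p .full∈ = lift λ full∈M → proper M-ideal (down M-ideal (λ _ → fromWitness (lift _)) full∈M)
    p .∅∉ (lift ∅∉M) = ∅∉M (down M-ideal (λ x∈∅ → ⊥-elim (lower (toWitness x∈∅))) (empty M-ideal))
    p .upward B⊆C (lift B∉M) =
      lift λ C∈M → B∉M (down M-ideal (λ x∈B → fromWitness (B⊆C (toWitness x∈B))) C∈M)
    p .∩-closed {B} {C} (lift B∉M) (lift C∉M) with M-prime (χ B) | M-prime (χ C)
    ... | inj₁ B∈M  | _         = contradiction B∈M B∉M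
    ... | inj₂ _    | inj₁ C∈M  = contradiction C∈M C∉M
    ... | inj₂ ∁B∈M | inj₂ ∁C∈M = lift (not-covered cover (join M-ideal ∁B∈M ∁C∈M))
      where
      cover : ∀ x → T (not (χ B x) ∨ not (χ C x)) ⊎ T (χ (B ∩ C) x)
      cover x with em _ {x ∈ B} | em _ {x ∈ C}
      ... | no _    | _       = inj₁ _
      ... | yes _   | no _    = inj₁ _
      ... | yes x∈B | yes x∈C = inj₂ (fromWitness (x∈B , x∈C))
    p .ultra B with M-prime (χ B)
    ... | inj₁ B∈M  = inj₂ (lift (not-covered (χ-or-∁ B) B∈M))
    ... | inj₂ ∁B∈M = inj₁ (lift (not-covered cover ∁B∈M))
      where
      cover : ∀ x → T (not (χ B x)) ⊎ T (χ B x)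
      cover x with χ B x
      ... | true  = inj₂ _
      ... | false = inj₁ _

    ∁∈p : (FT ^∧) p
    ∁∈p B B∈FT = lift (not-covered (χ-or-∁ B)
      (small⇒M (fromWitness (B , B∈FT , λ _ _ → toWitness))))

    A∈p : A ∈ᵘ p
    A∈p = lift λ A∈M → not-covered (χ-or-∁ A) A∈M
      (small⇒M (fromWitness (∅ , ∅∈FT , λ _ x∈A x∉A → contradiction x∈A (toWitness x∉A))))

  -- A sparse set that is not finitely thin.

  module Sparse (full-infinite : Infinite full) where

    open import Relation.Binary.Reasoning.Setoid setoid

    products : List Carrier → List Carrier
    products xs = cartesianProductWith _∙_ xs xs

    quotients : List Carrier → List Carrier
    quotients xs = cartesianProductWith _//_ (products xs) (products xs)

    -- A relation a ∙ t l ≈ u ∙ (b ∙ c) with a, b, c among earlier terms and u a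
    -- quotient of products of such would put t l in this list.
    avoid : List Carrier → List Carrier
    avoid xs = xs ++ cartesianProductWith _\\_ xs (cartesianProductWith _∙_ (quotients xs) (products xs))

    ∈-∙ : ∀ {x y xs ys} → x ∈ˡ xs → y ∈ˡ ys → x ∙ y ∈ˡ cartesianProductWith _∙_ xs ys
    ∈-∙ = Mem.∈-cartesianProductWith⁺ setoid setoid setoid ∙-cong

    ∈-// : ∀ {x y xs ys} → x ∈ˡ xs → y ∈ˡ ys → x // y ∈ˡ cartesianProductWith _//_ xs ys
    ∈-// = Mem.∈-cartesianProductWith⁺ setoid setoid setoid //-cong₂

    ∈-\\ : ∀ {x y xs ys} → x ∈ˡ xs → y ∈ˡ ys → x \\ y ∈ˡ cartesianProductWith _\\_ xs ys
    ∈-\\ = Mem.∈-cartesianProductWith⁺ setoid setoid setoid \\-cong₂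

    ∈-resp : ∀ {x y xs} → x ≈ y → x ∈ˡ xs → y ∈ˡ xs
    ∈-resp = Mem.∈-resp-≈ setoid

    opaque
      fresh : List Carrier → Carrier
      fresh xs = proj₁ (infinite⇒fresh full full-infinite xs)

      S : ℕ → List Carrier
      -- Having `ε` among the terms makes shorter words special cases of the relation in `escape`.
      S zero    = [ ε ]
      S (suc m) = fresh (avoid (S m)) ∷ S m

      t : ℕ → Carrier
      t m = fresh (avoid (S m))

      t∉avoid : ∀ l {x} → t l ≈ x → x ∉ˡ avoid (S l)
      t∉avoid l t≈x x∈ = proj₂ (proj₂ (infinite⇒fresh full full-infinite (avoid (S l)))) (∈-resp (sym t≈x) x∈)

      S-mono : m ≤ n → ∀ {x} → x ∈ˡ S m → x ∈ˡ S n
      S-mono m≤n = go (ℕ.≤⇒≤′ m≤n)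
        where
        go : m ≤′ n → ∀ {x} → x ∈ˡ S m → x ∈ˡ S n
        go ≤′-refl       x∈ = x∈
        go (≤′-step m≤n) x∈ = there (go m≤n x∈)

      ε∈S : ∀ m → ε ∈ˡ S m
      ε∈S m = S-mono (z≤n {m}) (here refl)

      t∈S : ∀ {i m} → i < m → t i ∈ˡ S m
      t∈S i<m = S-mono i<m (here refl)

    quotients-mono : m ≤ n → ∀ {x} → x ∈ˡ quotients (S m) → x ∈ˡ quotients (S n)
    quotients-mono {m} {n} m≤n {x} x∈ =
      let p , q , p∈ , q∈ , x≈ = Mem.∈-cartesianProductWith⁻ setoid setoid setoid _//_
                                   (products (S m)) (products (S m)) x∈
      in ∈-resp (sym x≈) (∈-// (mono p∈) (mono q∈))
      where
      mono : ∀ {y} → y ∈ˡ products (S m) → y ∈ˡ products (S n)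
      mono y∈ =
        let a , b , a∈ , b∈ , y≈ = Mem.∈-cartesianProductWith⁻ setoid setoid setoid _∙_ (S m) (S m) y∈
        in ∈-resp (sym y≈) (∈-∙ (S-mono m≤n a∈) (S-mono m≤n b∈))

    t-injective : ∀ {i j} → t i ≈ t j → i ≡ j
    t-injective {i} {j} eq with ℕ.<-cmp i j
    ... | tri< i<j _ _ = contradiction (Mem.∈-++⁺ˡ setoid (t∈S i<j)) (t∉avoid j (sym eq))
    ... | tri≈ _ i≡j _ = i≡j
    ... | tri> _ _ j<i = contradiction (Mem.∈-++⁺ˡ setoid (t∈S j<i)) (t∉avoid i eq)

    -- Either u is a short word in the first m terms, and then the choice of t l
    -- excludes l ≥ m, or it never is, and then there is no such relation at all.
    escape : ∀ u → ∃[ N ] ∀ {l a b c} → a ∈ˡ S l → b ∈ˡ S l → c ∈ˡ S l →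
             a ∙ t l ≈ u ∙ (b ∙ c) → l < N
    escape u with em _ {∃[ m ] u ∈ˡ quotients (S m)}
    ... | yes (m , u∈) = m , λ {l} a∈ b∈ c∈ eq → ℕ.≰⇒> λ m≤l →
      t∉avoid l (y≈x\\z _ _ _ eq) (Mem.∈-++⁺ʳ setoid (S l)
        (∈-\\ a∈ (∈-∙ (quotients-mono m≤l u∈) (∈-∙ b∈ c∈))))
    ... | no none = 0 , λ {l} a∈ b∈ c∈ eq → contradiction
      (suc l , ∈-resp (sym (x≈z//y _ _ _ (sym eq)))
        (∈-// (∈-∙ (S-mono (ℕ.n≤1+n l) a∈) (t∈S ℕ.≤-refl))
              (∈-∙ (S-mono (ℕ.n≤1+n l) b∈) (S-mono (ℕ.n≤1+n l) c∈)))) none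

    -- For each entry `x`, apply `escape x` with all three short factors equal to `ε`.
    t-leaves-lists : ∀ xs → ∃[ N ] ∀ {l} → t l ∈ˡ xs → l < N
    t-leaves-lists [] = 0 , λ ()
    t-leaves-lists (x ∷ xs) =
      let M , bound = escape x
          N , rest  = t-leaves-lists xs
      in M ⊔ N , λ { {l} (here t≈x) → ℕ.m<n⇒m<n⊔o N (bound (ε∈S l) (ε∈S l) (ε∈S l)
                       (trans (identityˡ _) (trans t≈x (sym (trans (∙-congˡ (identityˡ ε)) (identityʳ x))))))
                   ; (there t∈xs)   → ℕ.m<n⇒m<o⊔n M (rest t∈xs) }

    transport : ∀ {f g x y} → f ∙ x ≈ g ∙ y → x ≈ (f \\ g) ∙ y
    transport {f} {g} {x} {y} eq = begin
      x              ≈⟨ y≈x\\z f x _ eq ⟩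
      f \\ (g ∙ y)   ≈⟨ assoc _ g y ⟨
      (f \\ g) ∙ y   ∎

    -- The later of `t j` and `t l` stands last on its side, so moving `f` or `g` across gives a
    -- relation that `escape` bounds. If `l` is the larger index, its bound also bounds `j`.
    products-collide : ∀ f g → ∃[ N ] ∀ {i j k l} → i < j → k < l →
                       f ∙ (t i ∙ t j) ≈ g ∙ (t k ∙ t l) → j ≢ l → j < N
    products-collide f g = M ⊔ N , bound
      where
      M = proj₁ (escape (f \\ g))
      N = proj₁ (escape (g \\ f))

      bound : ∀ {i j k l} → i < j → k < l → f ∙ (t i ∙ t j) ≈ g ∙ (t k ∙ t l) → j ≢ l → j < M ⊔ N
      bound {i} {j} {k} {l} i<j k<l eq j≢l with ℕ.<-cmp j l
      ... | tri≈ _ j≡l _ = contradiction j≡l j≢l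
      ... | tri> _ _ l<j = ℕ.m<n⇒m<n⊔o N
        (proj₂ (escape (f \\ g)) (t∈S i<j) (t∈S (ℕ.<-trans k<l l<j)) (t∈S l<j) (transport eq))
      ... | tri< j<l _ _ = ℕ.m<n⇒m<o⊔n M (ℕ.<-trans j<l
        (proj₂ (escape (g \\ f)) (t∈S k<l) (t∈S (ℕ.<-trans i<j j<l)) (t∈S j<l) (transport (sym eq))))

    -- Equal indices would cancel to `f ≈ g`. Otherwise `escape` bounds the larger index, after
    -- padding with `ε`.
    translates-collide : ∀ f g → ¬ f ≈ g → ∃[ N ] ∀ {i k} → f ∙ t i ≈ g ∙ t k → i < N
    translates-collide f g f≉g = M ⊔ N , bound
      where
      M = proj₁ (escape (f \\ g))
      N = proj₁ (escape (g \\ f))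

      pad : ∀ {h h′ i k} → h ∙ t i ≈ h′ ∙ t k → ε ∙ t i ≈ (h \\ h′) ∙ (t k ∙ ε)
      pad eq = trans (identityˡ _) (trans (transport eq) (∙-congˡ (sym (identityʳ _))))

      bound : ∀ {i k} → f ∙ t i ≈ g ∙ t k → i < M ⊔ N
      bound {i} {k} eq with ℕ.<-cmp i k
      ... | tri≈ _ ≡.refl _ = contradiction (∙-cancelʳ (t i) f g eq) f≉g
      ... | tri> _ _ k<i = ℕ.m<n⇒m<n⊔o N
        (proj₂ (escape (f \\ g)) (ε∈S i) (t∈S k<i) (ε∈S i) (pad eq))
      ... | tri< i<k _ _ = ℕ.m<n⇒m<o⊔n M (ℕ.<-trans i<k
        (proj₂ (escape (g \\ f)) (ε∈S k) (t∈S i<k) (ε∈S k) (pad (sym eq))))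

    -- The interval offers `ν j + 1` values of `i`, as many as the translates in `Thin (ν j)`. Its
    -- lower end lets `i` bound `ν j`; its upper end lets `ν j` bound `i`.
    Linked : ℕ → ℕ → Set
    Linked i j = i < j × ν j ≤ i × i ≤ 2 * ν j

    A : Subset
    A .pred x = Lift c (∃₂ λ i j → Linked i j × x ≈ t i ∙ t j)
    A .resp x≈y (lift (i , j , ij , x≈)) = lift (i , j , ij , trans (sym x≈y) x≈)

    A∉FT : ¬ FT A
    A∉FT (n , thin) with thin g g-injective
      where
      g : Fin (suc n) → Carrier
      g i = t (n + toℕ i) ⁻¹
      g-injective : ∀ {i j} → g i ≈ g j → i ≡ j
      g-injective eq = toℕ-injective (ℕ.+-cancelˡ-≡ n _ _ (t-injective (⁻¹-injective eq)))
    ... | ys , ⊆ys with t-leaves-lists ys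
    -- The summand `suc (n + n)` gives `n + toℕ i < j` for every `i`; the summand `N` contradicts
    -- `bound`, since `t j` lies in all the translates.
    ...   | N , bound with ν-fibre-unbounded n (N + suc (n + n))
    ...     | j , large , ≡.refl = ℕ.<⇒≱ (bound (⊆ys λ (lift i) →
                t (n + toℕ i) ∙ t j ,
                lift (n + toℕ i , j ,
                      ( ℕ.<-≤-trans (s≤s (n+i≤2n i)) (ℕ.≤-trans (ℕ.m≤n+m _ N) large)
                      , ℕ.m≤m+n n _
                      , ℕ.≤-trans (n+i≤2n i) (ℕ.≤-reflexive (cong (n +_) (≡.sym (ℕ.+-identityʳ n)))))
                     , refl) ,
                sym (\\-leftDividesʳ (t (n + toℕ i)) (t j))))
              (ℕ.≤-trans (ℕ.m≤m+n N _) large)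
      where
      n+i≤2n : ∀ (i : Fin (suc n)) → n + toℕ i ≤ n + n
      n+i≤2n i = ℕ.+-monoʳ-≤ n (toℕ≤pred[n] i)

    A-sparse : Sp A
    A-sparse X inf with infinite⇒fresh X inf []
    ... | f , f∈X , _ with infinite⇒fresh X inf [ f ]
    ... | g , g∈X , g∉ with translates-collide f g (λ f≈g → g∉ (here (sym f≈g)))
    -- This excludes every `h` with `f ∙ t i ≈ h ∙ t p` and both `i` and `p` below `2 * N`.
    ... | N , i<N with infinite⇒fresh X inf (map (f ∙_) (cartesianProductWith _//_ (S (2 * N)) (S (2 * N))))
    ... | h , h∈X , h∉ with products-collide f g | products-collide f h
    ... | K , j<K | L , j<L =
      listed (f ∷ g ∷ h ∷ []) , (_ , id) , listed-⊆ X (f∈X ∷ g∈X ∷ h∈X ∷ []) ,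
      map (f ∙_) (products (S (K ⊔ L))) ,
      λ y∈ → locate (y∈ (f , here refl)) (y∈ (g , there (here refl))) (y∈ (h , there (there (here refl))))
      where
      listed-small : ∀ {y i j} → y ≈ f ∙ (t i ∙ t j) → i < j → j < K ⊔ L →
                     y ∈ˡ map (f ∙_) (products (S (K ⊔ L)))
      listed-small y≈ i<j j< = ∈-resp (sym y≈)
        (Mem.∈-map⁺ setoid setoid ∙-congˡ (∈-∙ (t∈S (ℕ.<-trans i<j j<)) (t∈S j<)))

      cancel-last : ∀ {h i j k} → f ∙ (t i ∙ t j) ≈ h ∙ (t k ∙ t j) → f ∙ t i ≈ h ∙ t k
      cancel-last {j = j} eq = ∙-cancelʳ (t j) _ _ (trans (assoc _ _ _) (trans eq (sym (assoc _ _ _))))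

      locate : ∀ {y} → y ∈ f · A → y ∈ g · A → y ∈ h · A → y ∈ˡ map (f ∙_) (products (S (K ⊔ L)))
      locate {y} (a , lift (i , j , (i<j , νj≤i , _) , a≈) , y≈fa)
                 (b , lift (k , l , (k<l , _) , b≈) , y≈gb)
                 (d , lift (p , q , (p<q , _ , p≤2νq) , d≈) , y≈hd)
        with trans y≈fa (∙-congˡ a≈) | trans y≈gb (∙-congˡ b≈) | trans y≈hd (∙-congˡ d≈) | j ℕ.≟ l | j ℕ.≟ q
      -- Different last factors in two of the representations bound `j`, and with it `i`, so `y` is
      -- in the finite list.
      ... | y≈f | y≈g | _   | no j≢l     | _          =
        listed-small y≈f i<j (ℕ.m<n⇒m<n⊔o L (j<K i<j k<l (trans (sym y≈f) y≈g) j≢l))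
      ... | y≈f | _   | y≈h | yes _      | no j≢q     =
        listed-small y≈f i<j (ℕ.m<n⇒m<o⊔n K (j<L i<j p<q (trans (sym y≈f) y≈h) j≢q))
      -- With a common last factor, `f` and `g` give `i < N`, so `ν j < N` and `p < 2 * N`, and `h`
      -- is one of the excluded elements.
      ... | y≈f | y≈g | y≈h | yes ≡.refl | yes ≡.refl = contradiction
        (∈-resp (sym (trans (x≈z//y _ _ _ (sym (cancel-last (trans (sym y≈f) y≈h)))) (assoc f _ _)))
          (Mem.∈-map⁺ setoid setoid ∙-congˡ (∈-// (t∈S (ℕ.<-≤-trans i< (ℕ.m≤n*m N 2)))
            (t∈S (ℕ.≤-<-trans p≤2νq (ℕ.≤-<-trans (ℕ.*-monoʳ-≤ 2 νj≤i) (ℕ.*-monoʳ-< 2 i<)))))))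
        h∉
        where
        i< : i < N
        i< = i<N (cancel-last (trans (sym y≈f) y≈g))

theorem6p6 : (∀ a → ExcludedMiddle a) →
    (∀ a b → Extensionality a b) →
    ∀ {c ℓ} (G : Group c ℓ) → let open OnGroup G in
    Infinite full →
    (FT ⊂ Sp) × (closure G*G* ⊂ FT ^∧)
theorem6p6 em ext G inf =
  ((λ {B} → FT⊆Sp B) , λ Sp⊆FT → A∉FT (Sp⊆FT {A} A-sparse)) ,
  ((λ {r} → closure⊆FT^∧ r) , λ FT^∧⊆cl →
    let p , p∈FT^∧ , A∈p = ultrafilter-avoiding-FT A A∉FT
        -- If `p` were in the closure, its basic neighbourhood given by `A` would meet `G*G*`.
        r , r∈G*G* , A∈r = FT^∧⊆cl {p} p∈FT^∧ A A∈p
    in sparse∉G*G* r A A-sparse r∈G*G* A∈r)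
  where
  open Thinness em ext G
  open Sparse inf
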